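{- For all $n \ge 8$, $N_{2,3}(n) = N_{2,3}(n-1) + N_{2,3}(n-5)$, with initial values $N_{2,3}(5)=1$, $N_{2,3}(6)=0$, $N_{2,3}(7)=0$ (and $N_{2,3}(n)=0$ for $n<5$).
   Context: For positive integers $a<b$ and $n \ge 3$, an $(a,b)$-necklace of length $n$ is a circular arrangement of the integers $0,1,\ldots,n-1$ (each used exactly once) such that any two adjacent entries have difference $\pm a$ or $\pm b$. Two necklaces are considered the same if one is obtained from the other by rotation or reflection. $N_{a,b}(n)$ denotes the number of distinct $(a,b)$-necklaces of length $n$; equivalently, it is the number of Hamiltonian cycles (as undirected subgraphs) of the graph on $\{0,1,\ldots,n-1\}$ in which $x,y$ are adjacent if and only if $|x-y| \in \{a,b\}$. -}

module Defs where

open import Data.Fin.Base using (Fin; zero; suc; toℕ; fromℕ<; opposite)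
open import Data.Fin.Properties as Fin
  using (toℕ-injective; toℕ<n; toℕ-fromℕ<; opposite-prop; opposite-involutive; all?; any?)
open import Data.List.Base using (List; []; _∷_; length; lookup; allFin; deduplicate; cartesianProductWith)
open import Data.List.Membership.Propositional.Properties using (∈-allFin; ∈-lookup)
import Data.List.Membership.Setoid.Properties as Membership
import Data.List.Relation.Unary.All as All
open import Data.List.Relation.Unary.AllPairs using (_∷_)
open import Data.List.Relation.Unary.Any as Any using (Any; here; there)
import Data.List.Relation.Unary.Enumerates.Setoid.Properties as Enumerates
import Data.List.Relation.Unary.Unique.Setoid as Unique
import Data.List.Relation.Unary.Unique.DecSetoid.Properties as Unique
open import Data.Nat.Base using (ℕ; zero; suc; _+_; _*_; _%_; _≤_; ∣_-_∣; s≤s⁻¹)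
open import Data.Nat.DivMod
  using (_mod_; m%n<n; m%n%n≡m%n; %-distribˡ-+; [m+kn]%n≡m%n; m<n⇒m%n≡m)
open import Data.Nat.Properties as ℕ using (_≤?_; +-assoc; +-comm; m∸n+n≡m)
open import Data.Nat.Tactic.RingSolver using (solve-∀)
open import Data.Product.Base using (Σ; ∃; _×_; _,_; proj₁; proj₂)
open import Data.Sum.Base using (_⊎_; inj₁; inj₂)
open import Data.Vec.Functional using () renaming (_∷_ to _◂_)
open import Function.Base using (_∘_)
open import Function.Bundles using (Bijection)
open import Function.Definitions using (Injective; Bijective)
open import Level using (0ℓ)
open import Relation.Binary.Bundles using (Setoid; DecSetoid)
open import Relation.Binary.Definitions using (Decidable)
open import Relation.Binary.PropositionalEquality
  using (_≡_; _≗_; _→-setoid_; refl; sym; trans; cong; subst₂; module ≡-Reasoning)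
import Relation.Binary.PropositionalEquality.Properties as ≡
open import Relation.Nullary using (Dec; yes; no; contradiction)
open import Relation.Nullary.Decidable using (map′; _×-dec_; _⊎-dec_; _→-dec_)

------------------------------------------------------------------------
-- Necklaces

-- The n positions on the circle are Fin n, read modulo n.
rotate : ∀ {n} → ℕ → Fin n → Fin n
rotate {suc m} k i = (toℕ i + k) mod suc m

Arrangement : ℕ → Set
Arrangement n = Fin n → Fin n

-- f i is the entry at position i.  The requirement 3 ≤ n is part of the
-- notion of necklace, so there are none of length 0, 1 or 2.
record IsNecklace (a b : ℕ) {n : ℕ} (f : Arrangement n) : Set where
  field
    length≥3  : 3 ≤ n
    bijective : Bijective _≡_ _≡_ f
    adjacent  : ∀ i → let d = ∣ toℕ (f i) - toℕ (f (rotate 1 i)) ∣ in d ≡ a ⊎ d ≡ b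

Necklace : ℕ → ℕ → ℕ → Set
Necklace a b n = Σ (Arrangement n) (IsNecklace a b)

-- g is obtained from f by a rotation, or by a reflection of the circle;
-- every reflection is i ↦ opposite i (that is, n - 1 - i) followed by a rotation.
_∼_ : ∀ {n} → Arrangement n → Arrangement n → Set
f ∼ g = ∃ λ k → (g ≗ f ∘ rotate k) ⊎ (g ≗ f ∘ rotate k ∘ opposite)

------------------------------------------------------------------------
-- _∼_ is a decidable equivalence

module _ {m : ℕ} where
  private
    n = suc m

    toℕ-rotate : ∀ k (i : Fin n) → toℕ (rotate k i) ≡ (toℕ i + k) % n
    toℕ-rotate k i = toℕ-fromℕ< (m%n<n (toℕ i + k) n)

    %-absorbˡ : ∀ x y → (x % n + y) % n ≡ (x + y) % n
    %-absorbˡ x y = begin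
      (x % n + y) % n           ≡⟨ %-distribˡ-+ (x % n) y n ⟩
      (x % n % n + y % n) % n   ≡⟨ cong (λ z → (z + y % n) % n) (m%n%n≡m%n x n) ⟩
      (x % n + y % n) % n       ≡⟨ %-distribˡ-+ x y n ⟨
      (x + y) % n               ∎
      where open ≡-Reasoning

    %-absorbʳ : ∀ x y → (x + y % n) % n ≡ (x + y) % n
    %-absorbʳ x y = begin
      (x + y % n) % n   ≡⟨ cong (_% n) (+-comm x (y % n)) ⟩
      (y % n + x) % n   ≡⟨ %-absorbˡ y x ⟩
      (y + x) % n       ≡⟨ cong (_% n) (+-comm y x) ⟩
      (x + y) % n       ∎
      where open ≡-Reasoning

    %-cancelʳ : ∀ x y z → (x + z) % n ≡ (y + z) % n → x % n ≡ y % n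
    %-cancelʳ x y z eq = begin
      x % n                       ≡⟨ lem x ⟩
      ((x + z) % n + z * m) % n   ≡⟨ cong (λ w → (w + z * m) % n) eq ⟩
      ((y + z) % n + z * m) % n   ≡⟨ lem y ⟨
      y % n                       ∎
      where
      open ≡-Reasoning
      ring : ∀ x z m → x + z * suc m ≡ x + z + z * m
      ring = solve-∀
      lem : ∀ x → x % n ≡ ((x + z) % n + z * m) % n
      lem x = begin
        x % n                       ≡⟨ [m+kn]%n≡m%n x z n ⟨
        (x + z * n) % n             ≡⟨ cong (_% n) (ring x z m) ⟩
        (x + z + z * m) % n         ≡⟨ %-absorbˡ (x + z) (z * m) ⟨
        ((x + z) % n + z * m) % n   ∎

    toℕ-% : ∀ (i : Fin n) → toℕ i % n ≡ toℕ i
    toℕ-% i = m<n⇒m%n≡m (toℕ<n i)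

  rotate-% : ∀ k (i : Fin n) → rotate (k % n) i ≡ rotate k i
  rotate-% k i = toℕ-injective (begin
    toℕ (rotate (k % n) i)   ≡⟨ toℕ-rotate (k % n) i ⟩
    (toℕ i + k % n) % n      ≡⟨ %-absorbʳ (toℕ i) k ⟩
    (toℕ i + k) % n          ≡⟨ toℕ-rotate k i ⟨
    toℕ (rotate k i)         ∎)
    where open ≡-Reasoning

  rotate-rotate : ∀ j k (i : Fin n) → rotate j (rotate k i) ≡ rotate (k + j) i
  rotate-rotate j k i = toℕ-injective (begin
    toℕ (rotate j (rotate k i))   ≡⟨ toℕ-rotate j (rotate k i) ⟩
    (toℕ (rotate k i) + j) % n    ≡⟨ cong (λ x → (x + j) % n) (toℕ-rotate k i) ⟩
    ((toℕ i + k) % n + j) % n     ≡⟨ %-absorbˡ (toℕ i + k) j ⟩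
    (toℕ i + k + j) % n           ≡⟨ cong (_% n) (+-assoc (toℕ i) k j) ⟩
    (toℕ i + (k + j)) % n         ≡⟨ toℕ-rotate (k + j) i ⟨
    toℕ (rotate (k + j) i)        ∎)
    where open ≡-Reasoning

  rotate-n* : ∀ k (i : Fin n) → rotate (k * n) i ≡ i
  rotate-n* k i = toℕ-injective (begin
    toℕ (rotate (k * n) i)   ≡⟨ toℕ-rotate (k * n) i ⟩
    (toℕ i + k * n) % n      ≡⟨ [m+kn]%n≡m%n (toℕ i) k n ⟩
    toℕ i % n                ≡⟨ toℕ-% i ⟩
    toℕ i                    ∎)
    where open ≡-Reasoning

  private
    inverse-+ : ∀ k m → k * m + k ≡ k * suc m
    inverse-+ = solve-∀

    inverse-+′ : ∀ k m → k + k * m ≡ k * suc m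
    inverse-+′ = solve-∀

  rotate-inverseˡ : ∀ k (i : Fin n) → rotate (k * m) (rotate k i) ≡ i
  rotate-inverseˡ k i = trans (rotate-rotate (k * m) k i)
    (trans (cong (λ z → rotate z i) (inverse-+′ k m)) (rotate-n* k i))

  rotate-inverseʳ : ∀ k (i : Fin n) → rotate k (rotate (k * m) i) ≡ i
  rotate-inverseʳ k i = trans (rotate-rotate k (k * m) i)
    (trans (cong (λ z → rotate z i) (inverse-+ k m)) (rotate-n* k i))

  opposite-rotate : ∀ k (i : Fin n) → opposite (rotate k i) ≡ rotate (k * m) (opposite i)
  opposite-rotate k i = toℕ-injective (begin
    toℕ (opposite (rotate k i))         ≡⟨ toℕ-% (opposite (rotate k i)) ⟨
    toℕ (opposite (rotate k i)) % n     ≡⟨ %-cancelʳ (toℕ (opposite (rotate k i))) (toℕ (opposite i) + k * m) (toℕ i + k) sums ⟩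
    (toℕ (opposite i) + k * m) % n      ≡⟨ toℕ-rotate (k * m) (opposite i) ⟨
    toℕ (rotate (k * m) (opposite i))   ∎)
    where
    open ≡-Reasoning
    opp-+ : ∀ (j : Fin n) → toℕ (opposite j) + toℕ j ≡ m
    opp-+ j = trans (cong (_+ toℕ j) (opposite-prop j)) (m∸n+n≡m (s≤s⁻¹ (toℕ<n j)))
    ring : ∀ o k m t → o + k * m + (t + k) ≡ o + t + k * suc m
    ring = solve-∀
    r = rotate k i
    sums : (toℕ (opposite r) + (toℕ i + k)) % n ≡ (toℕ (opposite i) + k * m + (toℕ i + k)) % n
    sums = begin
      (toℕ (opposite r) + (toℕ i + k)) % n           ≡⟨ %-absorbʳ (toℕ (opposite r)) (toℕ i + k) ⟨
      (toℕ (opposite r) + (toℕ i + k) % n) % n       ≡⟨ cong (λ z → (toℕ (opposite r) + z) % n) (toℕ-rotate k i) ⟨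
      (toℕ (opposite r) + toℕ r) % n                 ≡⟨ cong (_% n) (trans (opp-+ r) (sym (opp-+ i))) ⟩
      (toℕ (opposite i) + toℕ i) % n                 ≡⟨ [m+kn]%n≡m%n (toℕ (opposite i) + toℕ i) k n ⟨
      (toℕ (opposite i) + toℕ i + k * n) % n         ≡⟨ cong (_% n) (ring (toℕ (opposite i)) k m (toℕ i)) ⟨
      (toℕ (opposite i) + k * m + (toℕ i + k)) % n   ∎

  rotate-opposite-involutive : ∀ k (i : Fin n) → rotate k (opposite (rotate k (opposite i))) ≡ i
  rotate-opposite-involutive k i = begin
    rotate k (opposite (rotate k (opposite i)))         ≡⟨ cong (rotate k) (opposite-rotate k (opposite i)) ⟩
    rotate k (rotate (k * m) (opposite (opposite i)))   ≡⟨ rotate-inverseʳ k (opposite (opposite i)) ⟩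
    opposite (opposite i)                               ≡⟨ opposite-involutive i ⟩
    i                                                   ∎
    where open ≡-Reasoning

∼-refl : ∀ {n} {f : Arrangement n} → f ∼ f
∼-refl {zero}      = 0 , inj₁ λ ()
∼-refl {suc m} {f} = 0 , inj₁ λ i → cong f (sym (rotate-n* 0 i))

∼-sym : ∀ {n} {f g : Arrangement n} → f ∼ g → g ∼ f
∼-sym {zero}      _            = 0 , inj₁ λ ()
∼-sym {suc m} {f} (k , inj₁ p) = k * m , inj₁ λ i →
  sym (trans (p (rotate (k * m) i)) (cong f (rotate-inverseʳ k i)))
∼-sym {suc m} {f} (k , inj₂ p) = k , inj₂ λ i →
  sym (trans (p (rotate k (opposite i))) (cong f (rotate-opposite-involutive k i)))

∼-trans : ∀ {n} {f g h : Arrangement n} → f ∼ g → g ∼ h → f ∼ h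
∼-trans {zero}      _            _            = 0 , inj₁ λ ()
∼-trans {suc m} {f} (j , inj₁ p) (k , inj₁ q) = k + j , inj₁ λ i →
  trans (q i) (trans (p _) (cong f (rotate-rotate j k i)))
∼-trans {suc m} {f} (j , inj₁ p) (k , inj₂ q) = k + j , inj₂ λ i →
  trans (q i) (trans (p _) (cong f (rotate-rotate j k (opposite i))))
∼-trans {suc m} {f} (j , inj₂ p) (k , inj₁ q) = k * m + j , inj₂ λ i →
  trans (q i) (trans (p _) (cong f (trans (cong (rotate j) (opposite-rotate k i))
    (rotate-rotate j (k * m) (opposite i)))))
∼-trans {suc m} {f} (j , inj₂ p) (k , inj₂ q) = k * m + j , inj₁ λ i →
  trans (q i) (trans (p _) (cong f (trans (cong (rotate j) (trans (opposite-rotate k (opposite i))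
    (cong (rotate (k * m)) (opposite-involutive i)))) (rotate-rotate j (k * m) i))))

∼-dec : ∀ {n} → Decidable (_∼_ {n})
∼-dec {zero}  f g = yes (0 , inj₁ λ ())
∼-dec {suc m} f g = map′ fwd bwd (any? λ (k : Fin n) →
    all? (λ i → g i Fin.≟ f (rotate (toℕ k) i))
    ⊎-dec all? (λ i → g i Fin.≟ f (rotate (toℕ k) (opposite i))))
  where
  n = suc m
  fwd : (∃ λ (k : Fin n) → (g ≗ f ∘ rotate (toℕ k)) ⊎ (g ≗ f ∘ rotate (toℕ k) ∘ opposite)) → f ∼ g
  fwd (k , p) = toℕ k , p
  reduce : ∀ k (i : Fin n) → rotate k i ≡ rotate (toℕ (k mod n)) i
  reduce k i = trans (sym (rotate-% k i))
    (cong (λ z → rotate z i) (sym (toℕ-fromℕ< (m%n<n k n))))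
  bwd : f ∼ g → ∃ λ (k : Fin n) → (g ≗ f ∘ rotate (toℕ k)) ⊎ (g ≗ f ∘ rotate (toℕ k) ∘ opposite)
  bwd (k , inj₁ p) = k mod n , inj₁ λ i → trans (p i) (cong f (reduce k i))
  bwd (k , inj₂ p) = k mod n , inj₂ λ i → trans (p i) (cong f (reduce k (opposite i)))

necklaceDecSetoid : ℕ → ℕ → ℕ → DecSetoid 0ℓ 0ℓ
necklaceDecSetoid a b n = record
  { Carrier = Necklace a b n
  ; _≈_ = λ x y → proj₁ x ∼ proj₁ y
  ; isDecEquivalence = record
    { isEquivalence = record
      { refl  = λ {x} → ∼-refl {f = proj₁ x}
      ; sym   = λ {x} {y} → ∼-sym {f = proj₁ x} {proj₁ y}
      ; trans = λ {x} {y} {z} → ∼-trans {f = proj₁ x} {proj₁ y} {proj₁ z}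
      }
    ; _≟_ = λ x y → ∼-dec (proj₁ x) (proj₁ y)
    }
  }

necklaceSetoid : ℕ → ℕ → ℕ → Setoid 0ℓ 0ℓ
necklaceSetoid a b n = DecSetoid.setoid (necklaceDecSetoid a b n)

------------------------------------------------------------------------
-- Enumerating the necklaces

allFunctions : ∀ m n → List (Fin m → Fin n)
allFunctions zero    n = (λ ()) ∷ []
allFunctions (suc m) n = cartesianProductWith _◂_ (allFin n) (allFunctions m n)

∈-allFunctions : ∀ {m n} (f : Fin m → Fin n) → Any (f ≗_) (allFunctions m n)
∈-allFunctions {zero}      f = here λ ()
∈-allFunctions {suc m} {n} f =
  Any.map eta (Membership.∈-cartesianProductWith⁺ (≡.setoid (Fin n)) (fun m) (fun (suc m))
    {f = _◂_} cong-◂ (∈-allFin (f zero)) (∈-allFunctions (f ∘ suc)))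
  where
  fun : ℕ → Setoid 0ℓ 0ℓ
  fun k = Fin k →-setoid Fin n
  cong-◂ : ∀ {x y : Fin n} {g h : Fin m → Fin n} → x ≡ y → g ≗ h → (x ◂ g) ≗ (y ◂ h)
  cong-◂ p q zero    = p
  cong-◂ p q (suc i) = q i
  eta : ∀ {g} → (f zero ◂ (f ∘ suc)) ≗ g → f ≗ g
  eta p zero    = p zero
  eta p (suc i) = p (suc i)

isNecklace? : ∀ a b {n} (f : Arrangement n) → Dec (IsNecklace a b f)
isNecklace? a b {n} f = map′ fwd bwd
  (3 ≤? n ×-dec inj? ×-dec all? (λ y → any? λ x → f x Fin.≟ y)
    ×-dec all? (λ i → (_ ℕ.≟ a) ⊎-dec (_ ℕ.≟ b)))
  where
  Adj : Set
  Adj = ∀ i → let d = ∣ toℕ (f i) - toℕ (f (rotate 1 i)) ∣ in d ≡ a ⊎ d ≡ b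
  inj? : Dec (∀ x y → f x ≡ f y → x ≡ y)
  inj? = all? λ x → all? λ y → (f x Fin.≟ f y) →-dec (x Fin.≟ y)
  fwd : 3 ≤ n × (∀ x y → f x ≡ f y → x ≡ y) × (∀ y → ∃ λ x → f x ≡ y) × Adj → IsNecklace a b f
  fwd (l , inj , surj , adj) = record
    { length≥3  = l
    ; bijective = (λ {x} {y} → inj x y) , λ y → proj₁ (surj y) , λ { refl → proj₂ (surj y) }
    ; adjacent  = adj
    }
  bwd : IsNecklace a b f → 3 ≤ n × (∀ x y → f x ≡ f y → x ≡ y) × (∀ y → ∃ λ x → f x ≡ y) × Adj
  bwd v = length≥3 , (λ _ _ → proj₁ bijective)
        , (λ y → proj₁ (proj₂ bijective y) , proj₂ (proj₂ bijective y) refl) , adjacent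
    where open IsNecklace v

isNecklace-resp : ∀ {a b n} {f g : Arrangement n} → f ≗ g → IsNecklace a b f → IsNecklace a b g
isNecklace-resp {a} {b} {f = f} {g} f≗g v = record
  { length≥3  = length≥3
  ; bijective = (λ {x} {y} p → proj₁ bijective (trans (f≗g x) (trans p (sym (f≗g y)))))
              , λ y → proj₁ (proj₂ bijective y)
                    , λ {z} p → trans (sym (f≗g z)) (proj₂ (proj₂ bijective y) p)
  ; adjacent  = λ i → subst₂ (λ s t → let d = ∣ toℕ s - toℕ t ∣ in d ≡ a ⊎ d ≡ b)
                             (f≗g i) (f≗g (rotate 1 i)) (adjacent i)
  }
  where open IsNecklace v

selectNecklaces : ∀ a b {n} → List (Arrangement n) → List (Necklace a b n)
selectNecklaces a b []       = []
selectNecklaces a b (f ∷ fs) with isNecklace? a b f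
... | yes v = (f , v) ∷ selectNecklaces a b fs
... | no  _ = selectNecklaces a b fs

∈-selectNecklaces : ∀ {a b n} (x : Necklace a b n) fs → Any (proj₁ x ≗_) fs →
                    Any (λ y → proj₁ x ∼ proj₁ y) (selectNecklaces a b fs)
∈-selectNecklaces {a} {b} (f , v) (g ∷ fs) p with isNecklace? a b g | p
... | yes _ | here f≗g = here (∼-resp f≗g)
  where
  ∼-resp : ∀ {n} {f g : Arrangement n} → f ≗ g → f ∼ g
  ∼-resp {zero}      _ = 0 , inj₁ λ ()
  ∼-resp {suc m} {f} q = 0 , inj₁ λ i → trans (sym (q i)) (cong f (sym (rotate-n* 0 i)))
... | yes _ | there q  = there (∈-selectNecklaces (f , v) fs q)
... | no ¬v | here f≗g = contradiction (isNecklace-resp f≗g v) ¬v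
... | no  _ | there q  = ∈-selectNecklaces (f , v) fs q

-- One representative of each class of necklaces.
distinctNecklaces : ∀ a b n → List (Necklace a b n)
distinctNecklaces a b n =
  deduplicate (DecSetoid._≟_ (necklaceDecSetoid a b n)) (selectNecklaces a b (allFunctions n n))

N : ℕ → ℕ → ℕ → ℕ
N a b n = length (distinctNecklaces a b n)

-- N a b n is the number of necklaces up to rotation and reflection.
N-counts : ∀ a b n → Bijection (≡.setoid (Fin (N a b n))) (necklaceSetoid a b n)
N-counts a b n = record
  { to        = lookup (distinctNecklaces a b n)
  ; cong      = Setoid.reflexive S ∘ cong (lookup (distinctNecklaces a b n))
  ; bijective = lookup-injective (Unique.deduplicate-! D (selectNecklaces a b (allFunctions n n)))
              , Enumerates.lookup-surjective S (Enumerates.deduplicate⁺ D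
                  λ x → ∈-selectNecklaces x (allFunctions n n) (∈-allFunctions (proj₁ x)))
  }
  where
  D = necklaceDecSetoid a b n
  S = necklaceSetoid a b n
  open Setoid S using (_≈_) renaming (sym to ≈-sym)
  lookup-injective : ∀ {xs} → Unique.Unique S xs → Injective _≡_ _≈_ (lookup xs)
  lookup-injective (_ ∷ _) {zero} {zero} p = refl
  lookup-injective (x∉ ∷ u) {zero} {suc j} p = contradiction p (All.lookup x∉ (∈-lookup j))
  lookup-injective {x ∷ xs} (x∉ ∷ u) {suc i} {zero} p =
    contradiction (≈-sym {lookup xs i} {x} p) (All.lookup x∉ (∈-lookup i))
  lookup-injective (_ ∷ u) {suc i} {suc j} p = cong suc (lookup-injective u p)

-- In a Hamiltonian cycle the vertex 0 has neighbours 2 and 3, and 1 has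
-- neighbours 3 and 4.  So the cycle, cut open between 0 and 2, reads
-- 0, 3, 1, then a path from 4 to 5 through all vertices ≥ 4 (just 4 if n = 5),
-- then 2.  Now consider a Hamiltonian path from k to k + 1 through all
-- vertices ≥ k.  The successor of k is k + 2 or k + 3, so removing k and
-- reversing leaves a path of the same kind that starts at k + 1, or a cycle on
-- the vertices ≥ k + 1 cut open between k + 1 and k + 3.  Hence, with A and N
-- counting such paths and cycles by their number of vertices,
-- N (n + 4) = A n and A (n + 1) = A n + N n for n ≥ 2.

module Submission where

open import Defs
open import Data.Fin.Base using (Fin; zero; suc; toℕ; fromℕ; fromℕ<; inject₁; opposite)
open import Data.Fin.Permutation using (↔⇒≡)
open import Data.Fin.Properties
  using (toℕ-injective; toℕ<n; toℕ-fromℕ<; toℕ-fromℕ; toℕ-inject₁; opposite-involutive; +↔⊎)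
open import Data.Fin.Relation.Unary.Top using (view; ‵fromℕ; ‵inject₁)
open import Data.List.Base using (List; []; _∷_; _∷ʳ_; [_]; reverse; _ʳ++_; iterate; length; tabulate; initLast; _∷ʳ′_)
open import Data.List.Membership.Propositional using (_∈_)
open import Data.List.Membership.Propositional.Properties using (∈-++⁺ˡ; ∈-++⁺ʳ; ∈-++⁻; ∈-tabulate⁺; ∈-tabulate⁻)
open import Data.List.Membership.Propositional.Properties.WithK using (unique∧set⇒bag)
open import Data.List.Properties
  using (reverse-++; unfold-reverse; reverse-involutive; reverse-injective; ∷-injectiveˡ; ∷-injectiveʳ
        ; ∷ʳ-injectiveˡ; ∷ʳ-injectiveʳ; length-iterate; tabulate-cong)
open import Data.List.Relation.Binary.BagAndSetEquality using (∼bag⇒↭)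
open import Data.List.Relation.Binary.Permutation.Propositional using (_↭_; ↭-refl; ↭-sym; ↭-trans; prep; swap; ↭⇒↭ₛ)
open import Data.List.Relation.Binary.Permutation.Propositional.Properties
  using (∈-resp-↭; drop-∷; ∷↭∷ʳ; ↭-reverse; ↭-length)
import Data.List.Relation.Binary.Permutation.Setoid.Properties as Perm
open import Data.List.Relation.Unary.All as All using (All; []; _∷_)
open import Data.List.Relation.Unary.All.Properties using (++⁻ˡ)
open import Data.List.Relation.Unary.AllPairs using ([]; _∷_)
open import Data.List.Relation.Unary.Any using (here; there)
open import Data.List.Relation.Unary.Linked as Linked using (Linked; []; [-]; _∷_)
open import Data.List.Relation.Unary.Unique.Propositional using (Unique)
open import Data.List.Relation.Unary.Unique.Propositional.Properties using (tabulate⁺)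
open import Data.Nat.Base using (ℕ; zero; suc; _+_; _*_; _∸_; _%_; _≤_; _<_; ∣_-_∣; z≤n; s≤s)
open import Data.Nat.DivMod using (m%n<n; m<n⇒m%n≡m; n%n≡0)
open import Data.Nat.Properties
  using (_≟_; ≤-refl; ≤-trans; <⇒≤; <⇒≢; ≤⇒≯; ≤∧≢⇒<; ≤-<-trans; n≤1+n; 1+n≢n; m<m+n; m+n≮n
        ; +-comm; +-suc; +-identityʳ; ∣-∣-comm; ∣m-m+n∣≡n)
open import Data.Product.Base using (∃; ∃₂; _×_; _,_; proj₁; proj₂)
open import Data.Sum.Base as Sum using (_⊎_; inj₁; inj₂)
open import Data.Sum.Function.Propositional using (_⊎-↔_)
open import Data.Vec.Functional using () renaming (_∷_ to _◂_)
open import Function.Base using (_∘_)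
open import Function.Bundles using (Bijection; _↔_; mk⇔; mk↔ₛ′)
import Function.Construct.Composition as Compose
import Function.Construct.Symmetry as Symmetry
open import Function.Definitions using (Injective)
open import Function.Properties.Bijection using (Bijection⇒Inverse)
open import Function.Properties.Inverse using (↔-sym; ↔-trans)
open import Level using (0ℓ)
open import Relation.Binary.Core using (Rel)
open import Relation.Binary.Definitions using (Symmetric)
open import Relation.Binary.PropositionalEquality
  using (_≡_; _≢_; _≗_; refl; sym; trans; cong; cong₂; subst; setoid)
open import Relation.Nullary using (¬_; yes; no; contradiction)

private
  variable
    A : Set
    R : Rel A 0ℓ
    m n : ℕ

-- Lists: reversal, chains and inner entries

reverse-ends : ∀ (x : A) xs y → reverse (x ∷ xs ∷ʳ y) ≡ y ∷ reverse xs ∷ʳ x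
reverse-ends x xs y = trans (unfold-reverse x (xs ∷ʳ y)) (cong (_∷ʳ x) (reverse-++ xs [ y ]))

¬∷ʳ≡[] : ∀ (xs : List A) {x} → ¬ xs ∷ʳ x ≡ []
¬∷ʳ≡[] [] ()
¬∷ʳ≡[] (_ ∷ _) ()

linked-ʳ++ : Symmetric R → ∀ {x : A} {xs ys} → Linked R (x ∷ xs) → Linked R (x ∷ ys) → Linked R (xs ʳ++ (x ∷ ys))
linked-ʳ++ R-sym [-]      q = q
linked-ʳ++ R-sym (r ∷ p) q = linked-ʳ++ R-sym p (R-sym r ∷ q)

linked-reverse : Symmetric R → ∀ {xs : List A} → Linked R xs → Linked R (reverse xs)
linked-reverse R-sym {[]}    p = []
linked-reverse R-sym {_ ∷ _} p = linked-ʳ++ R-sym p [-]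

linked-∷ʳ⁺ : ∀ (xs : List A) {x y} → Linked R (xs ∷ʳ x) → R x y → Linked R (xs ∷ʳ x ∷ʳ y)
linked-∷ʳ⁺ []           p       r = r ∷ [-]
linked-∷ʳ⁺ (_ ∷ [])     (q ∷ _) r = q ∷ r ∷ [-]
linked-∷ʳ⁺ (_ ∷ x ∷ xs) (q ∷ p) r = q ∷ linked-∷ʳ⁺ (x ∷ xs) p r

linked-∷ʳ⁻ : ∀ (xs : List A) {x y} → Linked R (xs ∷ʳ x ∷ʳ y) → Linked R (xs ∷ʳ x) × R x y
linked-∷ʳ⁻ []           (r ∷ _) = [-] , r
linked-∷ʳ⁻ (_ ∷ [])     (q ∷ r ∷ _) = q ∷ [-] , r
linked-∷ʳ⁻ (_ ∷ x ∷ xs) (q ∷ p) with linked-∷ʳ⁻ (x ∷ xs) p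
... | p′ , r = q ∷ p′ , r

-- The entries just before and just after `x`; they differ because nothing repeats. The outer
-- entries `w` and `e` ensure that every member of `s` has both.
two-neighbours : ∀ {x w e : A} s → x ∈ s → Linked R (w ∷ s ∷ʳ e) → Unique (w ∷ s ∷ʳ e) →
  ∃₂ λ a b → a ≢ b × R a x × R x b × a ∈ w ∷ s ∷ʳ e × b ∈ w ∷ s ∷ʳ e
two-neighbours (x ∷ [])    (here refl) (p ∷ q ∷ _) ((_ ∷ w≢e ∷ []) ∷ _) =
  _ , _ , w≢e , p , q , here refl , there (there (here refl))
two-neighbours (x ∷ y ∷ _) (here refl) (p ∷ q ∷ _) ((_ ∷ w≢y ∷ _) ∷ _) =
  _ , _ , w≢y , p , q , here refl , there (there (here refl))
two-neighbours (x ∷ s) (there x∈s) (_ ∷ l) (_ ∷ u) with two-neighbours s x∈s l u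
... | a , b , a≢b , p , q , a∈ , b∈ = a , b , a≢b , p , q , there a∈ , there b∈

-- Intervals of numbers and their permutations

∈-interval⁻ : ∀ k n {x} → x ∈ iterate suc k n → k ≤ x × x < k + n
∈-interval⁻ k (suc n) (here refl) = ≤-refl , m<m+n k (s≤s z≤n)
∈-interval⁻ k (suc n) {x} (there x∈) with ∈-interval⁻ (suc k) n x∈
... | k<x , x< = <⇒≤ k<x , subst (x <_) (sym (+-suc k n)) x<

∈-interval⁺ : ∀ k n {x} → k ≤ x → x < k + n → x ∈ iterate suc k n
∈-interval⁺ k zero    k≤x x< = contradiction (subst (_ <_) (+-identityʳ k) x<) (≤⇒≯ k≤x)
∈-interval⁺ k (suc n) {x} k≤x x< with k ≟ x
... | yes refl = here refl
... | no  k≢x  = there (∈-interval⁺ (suc k) n (≤∧≢⇒< k≤x k≢x) (subst (x <_) (+-suc k n) x<))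

interval-unique : ∀ k n → Unique (iterate suc k n)
interval-unique k zero    = []
interval-unique k (suc n) =
  All.tabulate (λ x∈ → <⇒≢ (proj₁ (∈-interval⁻ (suc k) n x∈))) ∷ interval-unique (suc k) n

unique-resp-↭ : ∀ {xs ys : List ℕ} → xs ↭ ys → Unique xs → Unique ys
unique-resp-↭ p = Perm.Unique-resp-↭ (setoid ℕ) (↭⇒↭ₛ p)

module Permuted {k n : ℕ} {l : List ℕ} (l↭ : l ↭ iterate suc k n) where

  unique : Unique l
  unique = unique-resp-↭ (↭-sym l↭) (interval-unique k n)

  lower : ∀ {x} → x ∈ l → k ≤ x
  lower x∈ = proj₁ (∈-interval⁻ k n (∈-resp-↭ l↭ x∈))

  -- A known larger entry shows that the interval is long enough to contain `x`, without any
  -- arithmetic on `n`.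
  downward : ∀ {x y} → y ∈ l → k ≤ x → x ≤ y → x ∈ l
  downward y∈ k≤x x≤y = ∈-resp-↭ (↭-sym l↭)
    (∈-interval⁺ k n k≤x (≤-<-trans x≤y (proj₂ (∈-interval⁻ k n (∈-resp-↭ l↭ y∈)))))

-- Adjacency by differences 2 and 3

Apart : ℕ → ℕ → Rel ℕ 0ℓ
Apart a b x y = let d = ∣ x - y ∣ in d ≡ a ⊎ d ≡ b

Apart-sym : ∀ {a b} → Symmetric (Apart a b)
Apart-sym {x = x} {y} = Sum.map (trans (∣-∣-comm y x)) (trans (∣-∣-comm y x))

-- A record, so that x and y can be inferred from an adjacency.
record Adj (x y : ℕ) : Set where
  constructor adj
  field difference : Apart 2 3 x y

Adj-sym : Symmetric Adj
Adj-sym {x} {y} (adj p) = adj (Apart-sym {x = x} {y} p)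

∣n-m+n∣≡m : ∀ m n → ∣ n - m + n ∣ ≡ m
∣n-m+n∣≡m m n = trans (cong ∣ n -_∣ (+-comm m n)) (∣m-m+n∣≡n n m)

adj₂ : ∀ x → Adj x (2 + x)
adj₂ x = adj (inj₁ (∣n-m+n∣≡m 2 x))

adj₃ : ∀ x → Adj x (3 + x)
adj₃ x = adj (inj₂ (∣n-m+n∣≡m 3 x))

∣-∣≡⇒ : ∀ x y {d} → ∣ x - y ∣ ≡ d → y ≡ d + x ⊎ x ≡ d + y
∣-∣≡⇒ zero    y       refl = inj₁ (sym (+-identityʳ y))
∣-∣≡⇒ (suc x) zero    refl = inj₂ (sym (+-identityʳ (suc x)))
∣-∣≡⇒ (suc x) (suc y) {d} eq = Sum.map (λ p → trans (cong suc p) (sym (+-suc d x)))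
                                       (λ p → trans (cong suc p) (sym (+-suc d y))) (∣-∣≡⇒ x y eq)

data Neighbour (x y : ℕ) : Set where
  up₂   : y ≡ 2 + x → Neighbour x y
  up₃   : y ≡ 3 + x → Neighbour x y
  down₂ : x ≡ 2 + y → Neighbour x y
  down₃ : x ≡ 3 + y → Neighbour x y

neighbour : ∀ {x y} → Adj x y → Neighbour x y
neighbour {x} {y} (adj (inj₁ eq)) = Sum.[ up₂ , down₂ ] (∣-∣≡⇒ x y eq)
neighbour {x} {y} (adj (inj₂ eq)) = Sum.[ up₃ , down₃ ] (∣-∣≡⇒ x y eq)

¬adj₁ : ∀ x → ¬ Adj x (1 + x)
¬adj₁ x p with neighbour p
... | up₂ ()
... | up₃ ()
... | down₂ ()
... | down₃ ()

-- Near the bottom of the vertex range, neighbours below `j` drop out. The few that remain, here and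
-- in the next two lemmas, force the shape of paths and cycles.
adj-min : ∀ {j y} → j ≤ y → Adj j y → y ≡ 2 + j ⊎ y ≡ 3 + j
adj-min {j} {y} j≤y p with neighbour p
... | up₂ q      = inj₁ q
... | up₃ q      = inj₂ q
... | down₂ refl = contradiction j≤y (m+n≮n 1 y)
... | down₃ refl = contradiction j≤y (m+n≮n 2 y)

adj-1+min : ∀ {j y} → j ≤ y → Adj (1 + j) y → y ≡ 3 + j ⊎ y ≡ 4 + j
adj-1+min {j} {y} j≤y p with neighbour p
... | up₂ q      = inj₁ q
... | up₃ q      = inj₂ q
... | down₂ refl = contradiction j≤y (m+n≮n 0 y)
... | down₃ refl = contradiction j≤y (m+n≮n 1 y)

adj-2+min : ∀ {j y} → j ≤ y → Adj (2 + j) y → y ≡ j ⊎ y ≡ 4 + j ⊎ y ≡ 5 + j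
adj-2+min {j} {y} j≤y p with neighbour p
... | up₂ q      = inj₂ (inj₁ q)
... | up₃ q      = inj₂ (inj₂ q)
... | down₂ refl = inj₁ refl
... | down₃ refl = contradiction j≤y (m+n≮n 0 y)

-- Recursive codes and the vertex lists they describe

-- Codes: arcPath k lists the vertices k, …, k + n - 1 from k to k + 1 along the
-- path coded by an Arc n, and cyclePath j lists j, …, j + n - 1 from j to its
-- neighbour j + 2 around the cycle coded by a Cycle n.

data Arc   : ℕ → Set
data Cycle : ℕ → Set

data Arc where
  point : Arc 1
  -- At least two vertices must remain: with only one, `k` would stand next to `1 + k`.
  hop   : Arc (2 + n) → Arc (3 + n)
  loop  : Cycle n → Arc (1 + n)

data Cycle where
  close : Arc n → Cycle (4 + n)

arcPath   : ℕ → Arc n → List ℕ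
cyclePath : ℕ → Cycle n → List ℕ

arcPath k point    = [ k ]
arcPath k (hop a)  = k ∷ reverse (arcPath (1 + k) a)
arcPath k (loop c) = k ∷ reverse (cyclePath (1 + k) c)

cyclePath j (close a) = j ∷ 3 + j ∷ 1 + j ∷ arcPath (4 + j) a ∷ʳ (2 + j)

-- Sorts the four forced vertices to the front, so that they can be added to or dropped from a
-- permutation of an interval one at a time.
cycle-front : ∀ j p → j ∷ 3 + j ∷ 1 + j ∷ p ∷ʳ (2 + j) ↭ j ∷ 1 + j ∷ 2 + j ∷ 3 + j ∷ p
cycle-front j p = prep _ (↭-trans (swap _ _ (↭-sym (∷↭∷ʳ _ p))) (prep _ (swap _ _ ↭-refl)))

arc-↭   : ∀ k (a : Arc n) → arcPath k a ↭ iterate suc k n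
cycle-↭ : ∀ j (c : Cycle n) → cyclePath j c ↭ iterate suc j n

arc-↭ k point    = ↭-refl
arc-↭ k (hop a)  = prep k (↭-trans (↭-reverse _) (arc-↭ (1 + k) a))
arc-↭ k (loop c) = prep k (↭-trans (↭-reverse _) (cycle-↭ (1 + k) c))

cycle-↭ j (close a) = ↭-trans (cycle-front j _) (prep _ (prep _ (prep _ (prep _ (arc-↭ (4 + j) a)))))

-- What follows `k` is the reversal of a list that begins with `1 + k`.
arc-ends : ∀ k (a : Arc (2 + n)) → ∃ λ r → arcPath k a ≡ k ∷ r ∷ʳ (1 + k)
arc-ends k (hop a) with arc-ends (1 + k) a
... | r , eq = 2 + k ∷ reverse r , cong (k ∷_) (trans (cong reverse eq) (reverse-ends (1 + k) r (2 + k)))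
arc-ends k (loop (close a)) =
  3 + k ∷ reverse (4 + k ∷ 2 + k ∷ arcPath (5 + k) a) ,
  cong (k ∷_) (reverse-ends (1 + k) (4 + k ∷ 2 + k ∷ arcPath (5 + k) a) (3 + k))

arc-linked   : ∀ k (a : Arc n) → Linked Adj (arcPath k a)
cycle-linked : ∀ j (c : Cycle n) → Linked Adj (cyclePath j c)

arc-linked k point   = [-]
arc-linked k (hop a) with arcPath (1 + k) a | arc-ends (1 + k) a | arc-linked (1 + k) a
... | _ | r , refl | l with reverse (1 + k ∷ r ∷ʳ (2 + k)) | reverse-ends (1 + k) r (2 + k) | linked-reverse Adj-sym l
... | _ | refl | l′ = adj₂ k ∷ l′
arc-linked k (loop c@(close a))
  with reverse (cyclePath (1 + k) c) | reverse-ends (1 + k) (4 + k ∷ 2 + k ∷ arcPath (5 + k) a) (3 + k)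
     | linked-reverse Adj-sym (cycle-linked (1 + k) c)
... | _ | refl | l = adj₃ k ∷ l

-- The final vertex `2 + j` is reached from `4 + j` if that is the whole arc, and otherwise from the
-- arc's far end `5 + j`.
cycle-linked j (close {1} point) = adj₃ j ∷ Adj-sym (adj₂ (1 + j)) ∷ adj₃ (1 + j) ∷ Adj-sym (adj₂ (2 + j)) ∷ [-]
cycle-linked j (close {suc (suc _)} a) with arcPath (4 + j) a | arc-ends (4 + j) a | arc-linked (4 + j) a
... | _ | r , refl | l =
  adj₃ j ∷ Adj-sym (adj₂ (1 + j)) ∷ adj₃ (1 + j) ∷ linked-∷ʳ⁺ (4 + j ∷ r) l (Adj-sym (adj₃ (2 + j)))

-- The second vertex tells them apart: `2 + k` after a hop, `3 + k` after a loop.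
hop≢loop : ∀ {k} (a : Arc (2 + n)) (c : Cycle (2 + n)) → arcPath k (hop a) ≢ arcPath k (loop c)
hop≢loop {k = k} a (close b) eq with arc-ends (1 + k) a
... | r , eq′ with trans (sym (trans (cong reverse eq′) (reverse-ends (1 + k) r (2 + k))))
                         (trans (∷-injectiveʳ eq) (reverse-ends (1 + k) (4 + k ∷ 2 + k ∷ arcPath (5 + k) b) (3 + k)))
... | p = contradiction (∷-injectiveˡ p) (λ q → 1+n≢n (sym q))

arcPath-injective   : ∀ k (a b : Arc n) → arcPath k a ≡ arcPath k b → a ≡ b
cyclePath-injective : ∀ j (c d : Cycle n) → cyclePath j c ≡ cyclePath j d → c ≡ d

arcPath-injective k point    point    eq = refl
arcPath-injective k point    (loop ()) eq
arcPath-injective k (loop ()) point   eq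
arcPath-injective k (hop a)  (hop b)  eq = cong hop (arcPath-injective _ a b (reverse-injective (∷-injectiveʳ eq)))
arcPath-injective k (hop a)  (loop c) eq = contradiction eq (hop≢loop a c)
arcPath-injective k (loop c) (hop a)  eq = contradiction (sym eq) (hop≢loop a c)
arcPath-injective k (loop c) (loop d) eq = cong loop (cyclePath-injective _ c d (reverse-injective (∷-injectiveʳ eq)))

cyclePath-injective j (close a) (close b) eq =
  cong close (arcPath-injective _ a b (∷ʳ-injectiveˡ _ _ (∷-injectiveʳ (∷-injectiveʳ (∷-injectiveʳ eq)))))

-- Completeness: every such path and cycle has a code

data Endpoints (k : ℕ) : List ℕ → Set where
  single : Endpoints k [ k ]
  double : ∀ r → Endpoints k (k ∷ r ∷ʳ (1 + k))

-- The helpers settle one entry each. `second` gives `3 + j`, since `2 + j` is used at the end;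
-- `third` gives `1 + j`; `fourth` gives `4 + j`, since `3 + j` is used; `last` finds the entry
-- before the final `2 + j`, which is `4 + j` or `5 + j`.
cycle-shape : ∀ j n s → j ∷ s ∷ʳ (2 + j) ↭ iterate suc j n → Linked Adj (j ∷ s ∷ʳ (2 + j)) →
              ∃ λ p → s ≡ 3 + j ∷ 1 + j ∷ p × Endpoints (4 + j) p
cycle-shape j n s l↭ link = second s unique lower 1+j∈ link
  where
  open Permuted l↭

  1+j∈ : 1 + j ∈ j ∷ s ∷ʳ (2 + j)
  1+j∈ = downward (there (∈-++⁺ʳ s (here refl))) (n≤1+n j) (n≤1+n (1 + j))

  last : ∀ t → Unique (j ∷ 3 + j ∷ 1 + j ∷ 4 + j ∷ t ∷ʳ (2 + j)) → All (j ≤_) t →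
         Linked Adj (4 + j ∷ t ∷ʳ (2 + j)) → Endpoints (4 + j) (4 + j ∷ t)
  last t u lower link with initLast t
  ... | [] = single
  last _ ((_ ∷ _ ∷ _ ∷ u₀) ∷ _ ∷ _ ∷ u₄ ∷ _) lower link | t ∷ʳ′ x
    with adj-2+min (All.lookup lower (∈-++⁺ʳ t (here refl))) (Adj-sym (proj₂ (linked-∷ʳ⁻ (4 + j ∷ t) link)))
  ... | inj₁ refl        = contradiction refl (All.lookup u₀ (∈-++⁺ˡ (∈-++⁺ʳ t (here refl))))
  ... | inj₂ (inj₁ refl) = contradiction refl (All.lookup u₄ (∈-++⁺ˡ (∈-++⁺ʳ t (here refl))))
  ... | inj₂ (inj₂ refl) = double t

  fourth : ∀ p → Unique (j ∷ 3 + j ∷ 1 + j ∷ p ∷ʳ (2 + j)) → All (j ≤_) p →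
           Linked Adj (1 + j ∷ p ∷ʳ (2 + j)) → Endpoints (4 + j) p
  fourth []      _ _ (adj₁ ∷ _) = contradiction adj₁ (¬adj₁ (1 + j))
  fourth (v ∷ t) u@(_ ∷ (_ ∷ 3+j≢v ∷ _) ∷ _) (j≤v ∷ lower) (adj₁ ∷ link) with adj-1+min j≤v adj₁
  ... | inj₁ refl = contradiction refl 3+j≢v
  ... | inj₂ refl = last t u lower link

  -- Inside s, both neighbours of 1 + j would have to be 4 + j.
  1+j∉interior : ∀ {w} s → Unique (3 + j ∷ w ∷ s ∷ʳ (2 + j)) → All (j ≤_) (w ∷ s ∷ʳ (2 + j)) →
                 Linked Adj (w ∷ s ∷ʳ (2 + j)) → ¬ 1 + j ∈ s
  1+j∉interior s (u₃ ∷ u) lower link 1+j∈s with two-neighbours s 1+j∈s link u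
  ... | a , b , a≢b , pa , pb , a∈ , b∈
    with adj-1+min (All.lookup lower a∈) (Adj-sym pa) | adj-1+min (All.lookup lower b∈) pb
  ... | inj₁ refl | _         = All.lookup u₃ a∈ refl
  ... | inj₂ _    | inj₁ refl = All.lookup u₃ b∈ refl
  ... | inj₂ refl | inj₂ refl = a≢b refl

  third : ∀ s → Unique (j ∷ 3 + j ∷ s ∷ʳ (2 + j)) → All (j ≤_) (s ∷ʳ (2 + j)) → 1 + j ∈ s ∷ʳ (2 + j) →
          Linked Adj (3 + j ∷ s ∷ʳ (2 + j)) → ∃ λ p → s ≡ 1 + j ∷ p × Endpoints (4 + j) p
  third [] _ _ (here ())
  third [] _ _ (there ())
  third (_ ∷ p) u (_ ∷ lower) (here refl) (_ ∷ link) = p , refl , fourth p u (++⁻ˡ p lower) link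
  third (_ ∷ s) (_ ∷ u) lower (there 1+j∈) (_ ∷ link) with ∈-++⁻ s 1+j∈
  ... | inj₁ 1+j∈s = contradiction 1+j∈s (1+j∉interior s u lower link)
  ... | inj₂ (here ())

  second : ∀ s → Unique (j ∷ s ∷ʳ (2 + j)) → (∀ {x} → x ∈ j ∷ s ∷ʳ (2 + j) → j ≤ x) →
           1 + j ∈ j ∷ s ∷ʳ (2 + j) → Linked Adj (j ∷ s ∷ʳ (2 + j)) →
           ∃ λ p → s ≡ 3 + j ∷ 1 + j ∷ p × Endpoints (4 + j) p
  second [] _ _ (there (here ()))
  second (z ∷ s) u lower 1+j∈ (adj₀ ∷ link) with adj-min (lower (there (here refl))) adj₀
  second (z ∷ s) (_ ∷ u ∷ _) _ _ _ | inj₁ refl = contradiction refl (All.lookup u (∈-++⁺ʳ s (here refl)))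
  second (z ∷ s) u lower (there (there 1+j∈)) (_ ∷ link) | inj₂ refl
    with third s u (All.tabulate (lower ∘ there ∘ there)) 1+j∈ link
  ... | p , refl , ends = p , refl , ends

-- Undoes one layer of `arcPath`: without `k` and turned round, a path ending in `y = 1 + k` starts
-- at the least vertex left.
reversed-↭ : ∀ {k n x r y} → k ∷ x ∷ r ∷ʳ y ↭ iterate suc k (suc n) →
             y ∷ reverse r ∷ʳ x ↭ iterate suc (suc k) n
reversed-↭ {k} {n} {x} {r} {y} p↭ =
  subst (_↭ iterate suc (1 + k) n) (reverse-ends x r y) (↭-trans (↭-reverse (x ∷ r ∷ʳ y)) (drop-∷ p↭))

reversed-linked : ∀ {x r y} → Linked Adj (x ∷ r ∷ʳ y) → Linked Adj (y ∷ reverse r ∷ʳ x)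
reversed-linked {x} {r} {y} link = subst (Linked Adj) (reverse-ends x r y) (linked-reverse Adj-sym link)

unreverse : ∀ (x : A) r y {l} → l ≡ y ∷ reverse r ∷ʳ x → reverse l ≡ x ∷ r ∷ʳ y
unreverse x r y eq =
  trans (cong reverse (trans eq (sym (reverse-ends x r y)))) (reverse-involutive (x ∷ r ∷ʳ y))

-- Mutual induction on the number of vertices: an arc loses its first vertex, a cycle its four
-- forced ones. The second vertex of an arc decides between `hop` and `loop`.
arcPath-surjective : ∀ n {k p} → Endpoints k p → p ↭ iterate suc k n → Linked Adj p →
                     ∃ λ (a : Arc n) → arcPath k a ≡ p
cyclePath-surjective : ∀ n {j} s → j ∷ s ∷ʳ (2 + j) ↭ iterate suc j n → Linked Adj (j ∷ s ∷ʳ (2 + j)) →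
                       ∃ λ (c : Cycle n) → cyclePath j c ≡ j ∷ s ∷ʳ (2 + j)

arcPath-surjective zero ends p↭ link with ends | ↭-length p↭
... | single   | ()
... | double _ | ()
arcPath-surjective 1             single p↭ link = point , refl
arcPath-surjective (suc (suc n)) single p↭ link = contradiction (↭-length p↭) λ ()
arcPath-surjective (suc n) {k} (double [])      p↭ (p ∷ _)    = contradiction p (¬adj₁ k)
arcPath-surjective (suc n) {k} (double (x ∷ r)) p↭ (kx ∷ link)
  with adj-min (Permuted.lower p↭ (there (here refl))) kx
... | inj₁ refl = hop′ (arcPath-surjective n (double (reverse r)) (reversed-↭ p↭) (reversed-linked link))
  where
  hop′ : ∀ {n} → (∃ λ (a : Arc n) → arcPath (1 + k) a ≡ 1 + k ∷ reverse r ∷ʳ (2 + k)) →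
         ∃ λ (a : Arc (suc n)) → arcPath k a ≡ k ∷ 2 + k ∷ r ∷ʳ (1 + k)
  -- One vertex cannot match a list with two separate ends. The split on the code also brings the
  -- index into the form `2 + n` that `hop` asks for.
  hop′ (point , eq) = contradiction (sym (∷-injectiveʳ eq)) (¬∷ʳ≡[] (reverse r))
  hop′ (a@(hop _) , eq) = hop a , cong (k ∷_) (unreverse (2 + k) r (1 + k) eq)
  hop′ (a@(loop (close _)) , eq) = hop a , cong (k ∷_) (unreverse (2 + k) r (1 + k) eq)
... | inj₂ refl with cyclePath-surjective n (reverse r) (reversed-↭ p↭) (reversed-linked link)
...   | c , eq = loop c , cong (k ∷_) (unreverse (3 + k) r (1 + k) eq)

cyclePath-surjective n {j} s s↭ link with cycle-shape j n s s↭ link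
... | p , refl , ends = extend n (↭-trans (↭-sym (cycle-front j p)) s↭)
  where
  init : ∀ {p x} → Endpoints (4 + j) p → Linked Adj (p ∷ʳ x) → Linked Adj p
  init single     _    = [-]
  init (double r) link = proj₁ (linked-∷ʳ⁻ (4 + j ∷ r) link)

  extend : ∀ n → j ∷ 1 + j ∷ 2 + j ∷ 3 + j ∷ p ↭ iterate suc j n →
           ∃ λ (c : Cycle n) → cyclePath j c ≡ j ∷ 3 + j ∷ 1 + j ∷ p ∷ʳ (2 + j)
  extend 0 p↭ = contradiction (↭-length p↭) λ ()
  extend 1 p↭ = contradiction (↭-length p↭) λ ()
  extend 2 p↭ = contradiction (↭-length p↭) λ ()
  extend 3 p↭ = contradiction (↭-length p↭) λ ()
  extend (suc (suc (suc (suc n)))) p↭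
    with arcPath-surjective n ends (drop-∷ (drop-∷ (drop-∷ (drop-∷ p↭))))
                                   (init ends (Linked.tail (Linked.tail (Linked.tail link))))
  ... | a , eq = close a , cong (λ p → j ∷ 3 + j ∷ 1 + j ∷ p ∷ʳ (2 + j)) eq

-- Functions on positions as lists

tabulate-∷ʳ : ∀ (g : Fin (suc m) → A) → tabulate g ≡ tabulate (g ∘ inject₁) ∷ʳ g (fromℕ m)
tabulate-∷ʳ {zero}  g = refl
tabulate-∷ʳ {suc m} g = cong (g zero ∷_) (tabulate-∷ʳ (g ∘ suc))

linked-tabulate⁺ : ∀ (g : Fin (suc m) → A) → (∀ i → R (g (inject₁ i)) (g (suc i))) → Linked R (tabulate g)
linked-tabulate⁺ {zero}  g p = [-]
linked-tabulate⁺ {suc m} g p = p zero ∷ linked-tabulate⁺ (g ∘ suc) (p ∘ suc)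

linked-tabulate⁻ : ∀ (g : Fin (suc m) → A) → Linked R (tabulate g) → ∀ i → R (g (inject₁ i)) (g (suc i))
linked-tabulate⁻ g (r ∷ l) zero    = r
linked-tabulate⁻ g (r ∷ l) (suc i) = linked-tabulate⁻ (g ∘ suc) l i

unique-tabulate⁻ : ∀ {g : Fin n → A} → Unique (tabulate g) → Injective _≡_ _≡_ g
unique-tabulate⁻ u       {zero}  {zero}  eq = refl
unique-tabulate⁻ (p ∷ u) {zero}  {suc j} eq = contradiction eq (All.lookup p (∈-tabulate⁺ j))
unique-tabulate⁻ (p ∷ u) {suc i} {zero}  eq = contradiction (sym eq) (All.lookup p (∈-tabulate⁺ i))
unique-tabulate⁻ (p ∷ u) {suc i} {suc j} eq = cong suc (unique-tabulate⁻ u eq)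

tabulate-injective : ∀ (g h : Fin n → A) → tabulate g ≡ tabulate h → g ≗ h
tabulate-injective g h eq zero    = ∷-injectiveˡ eq
tabulate-injective g h eq (suc i) = tabulate-injective (g ∘ suc) (h ∘ suc) (∷-injectiveʳ eq) i

untabulate : ∀ {l} → All (_< n) l → length l ≡ m → ∃ λ (f : Fin m → Fin n) → tabulate (toℕ ∘ f) ≡ l
untabulate []        refl = (λ ()) , refl
untabulate (x< ∷ l<) refl with untabulate l< refl
... | f , eq = (fromℕ< x< ◂ f) , cong₂ _∷_ (toℕ-fromℕ< x<) eq

entries : Arrangement n → List ℕ
entries f = tabulate (toℕ ∘ f)

-- Rotations of the circle

module _ {m : ℕ} where

  toℕ-rotate : ∀ k (i : Fin (suc m)) → toℕ (rotate k i) ≡ (toℕ i + k) % suc m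
  toℕ-rotate k i = toℕ-fromℕ< (m%n<n (toℕ i + k) (suc m))

  rotate-small : ∀ k (i : Fin (suc m)) → toℕ i + k < suc m → toℕ (rotate k i) ≡ toℕ i + k
  rotate-small k i lt = trans (toℕ-rotate k i) (m<n⇒m%n≡m lt)

  rotate-inject₁ : ∀ (i : Fin m) → rotate 1 (inject₁ i) ≡ suc i
  rotate-inject₁ i = toℕ-injective (trans (rotate-small 1 (inject₁ i) (subst (_< suc m) (sym eq) (s≤s (toℕ<n i)))) eq)
    where
    eq : toℕ (inject₁ i) + 1 ≡ suc (toℕ i)
    eq = trans (cong (_+ 1) (toℕ-inject₁ i)) (+-comm (toℕ i) 1)

  rotate-last : rotate 1 (fromℕ m) ≡ zero
  rotate-last = toℕ-injective (trans (toℕ-rotate 1 (fromℕ m))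
    (trans (cong (_% suc m) (trans (cong (_+ 1) (toℕ-fromℕ m)) (+-comm m 1))) (n%n≡0 (suc m))))

  rotate-zero : ∀ (i : Fin (suc m)) → rotate (toℕ i) zero ≡ i
  rotate-zero i = toℕ-injective (rotate-small (toℕ i) zero (toℕ<n i))

  rotate-comm : ∀ j k (i : Fin (suc m)) → rotate j (rotate k i) ≡ rotate k (rotate j i)
  rotate-comm j k i = trans (rotate-rotate j k i)
    (trans (cong (λ s → rotate s i) (+-comm k j)) (sym (rotate-rotate k j i)))

  rotate-injective : ∀ k → Injective _≡_ _≡_ (rotate {suc m} k)
  rotate-injective k {i} {j} eq =
    trans (sym (rotate-inverseˡ k i)) (trans (cong (rotate (k * m)) eq) (rotate-inverseˡ k j))

  -- Rotations commute and act transitively, so one fixed position makes all positions fixed.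
  rotate-fixed : ∀ k (i : Fin (suc m)) → rotate k i ≡ i → ∀ j → rotate k j ≡ j
  rotate-fixed k i fixed j = subst (λ j → rotate k j ≡ j) reach
    (trans (rotate-comm k s i) (cong (rotate s) fixed))
    where
    -- Since `m` is -1 modulo `suc m`, this goes back from `i` to position 0 and then on to `j`.
    s = toℕ i * m + toℕ j
    reach : rotate s i ≡ j
    reach = trans (sym (rotate-rotate (toℕ j) (toℕ i * m) i))
      (trans (cong (rotate (toℕ j)) (trans (cong (rotate (toℕ i * m)) (sym (rotate-zero i)))
                                           (rotate-inverseˡ (toℕ i) zero)))
             (rotate-zero j))

-- Symmetries of necklaces and a normal form

module _ {a b : ℕ} where

  necklace-rotate : ∀ k {f : Arrangement n} → IsNecklace a b f → IsNecklace a b (f ∘ rotate k)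
  necklace-rotate {suc m} k {f} v = record
    { length≥3  = length≥3
    ; bijective = rotate-injective k ∘ proj₁ bijective
                , λ y → rotate (k * m) (proj₁ (proj₂ bijective y))
                      , λ { refl → proj₂ (proj₂ bijective y) (rotate-inverseʳ k _) }
    ; adjacent  = λ i →
        subst (Apart a b (toℕ (f (rotate k i))) ∘ toℕ ∘ f) (rotate-comm 1 k i) (adjacent (rotate k i))
    }
    where open IsNecklace v

  necklace-opposite : ∀ {f : Arrangement n} → IsNecklace a b f → IsNecklace a b (f ∘ opposite)
  necklace-opposite {suc m} {f} v = record
    { length≥3  = length≥3
    ; bijective = opposite-injective ∘ proj₁ bijective
                , λ y → opposite (proj₁ (proj₂ bijective y))
                      , λ { refl → proj₂ (proj₂ bijective y) (opposite-involutive _) }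
    -- A reflection runs the circle backwards: the pair at `i` is the original pair at `j`, read in
    -- the other order.
    ; adjacent  = λ i → let j = opposite (rotate 1 i) in
        Apart-sym {x = toℕ (f j)} (subst (Apart a b (toℕ (f j)) ∘ toℕ ∘ f) (back i) (adjacent j))
    }
    where
    open IsNecklace v
    opposite-injective : Injective _≡_ _≡_ (opposite {suc m})
    opposite-injective {i} {j} eq =
      trans (sym (opposite-involutive i)) (trans (cong opposite eq) (opposite-involutive j))
    back : ∀ i → rotate 1 (opposite (rotate 1 i)) ≡ opposite i
    back i = trans (cong (rotate 1) (opposite-rotate 1 i)) (rotate-inverseʳ 1 (opposite i))

-- Picks one arrangement from each class of (2,3)-necklaces: the place of 0 fixes the rotation, and
-- the place of 2, one of the two neighbours of 0, fixes the direction.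
record Normal (f : Arrangement (suc m)) : Set where
  field
    first : toℕ (f zero) ≡ 0
    last  : toℕ (f (fromℕ m)) ≡ 2

open Normal

-- A rotation that keeps 0 in place is trivial. In a reflection, `rotate k` would exchange the first
-- and last positions; as it commutes with `rotate 1`, the last position would be the second,
-- against length at least 3.
normal-∼⇒≗ : ∀ {f g : Arrangement (suc m)} → IsNecklace 2 3 f → Normal f → Normal g → f ∼ g → f ≗ g
normal-∼⇒≗ {m} {f} {g} v nf ng (k , inj₁ p) i =
  trans (cong f (sym (rotate-fixed k zero fixed i))) (sym (p i))
  where
  open IsNecklace v
  fixed : rotate k zero ≡ zero
  fixed = proj₁ bijective (toℕ-injective (trans (cong toℕ (sym (p zero))) (trans (first ng) (sym (first nf)))))
normal-∼⇒≗ {m} {f} {g} v nf ng (k , inj₂ p) i =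
  contradiction (subst (λ m → 3 ≤ suc m) (sym 1≡m) length≥3) λ { (s≤s (s≤s ())) }
  where
  open IsNecklace v
  zero↦ : rotate k zero ≡ fromℕ m
  zero↦ = proj₁ bijective (toℕ-injective (trans (cong (toℕ ∘ f ∘ rotate k) (sym (opposite-involutive zero)))
    (trans (cong toℕ (sym (p (fromℕ m)))) (trans (last ng) (sym (last nf))))))
  last↦ : rotate k (fromℕ m) ≡ zero
  last↦ = proj₁ bijective (toℕ-injective (trans (cong toℕ (sym (p zero))) (trans (first ng) (sym (first nf)))))
  1↦m : rotate 1 zero ≡ fromℕ m
  1↦m = trans (cong (rotate 1) (sym last↦))
    (trans (rotate-comm 1 k (fromℕ m)) (trans (cong (rotate k) rotate-last) zero↦))
  1≡m : 1 ≡ m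
  1≡m = trans (sym (rotate-small 1 zero (≤-trans (s≤s (s≤s z≤n)) length≥3)))
    (trans (cong toℕ 1↦m) (toℕ-fromℕ m))

-- The 0 is followed by 2 or 3. If by 2, a reflection moves the 2 to the other side; if by 3, the
-- entry before the 0 must be 2.
normalise : ∀ (f : Arrangement (suc m)) → IsNecklace 2 3 f → ∃ λ g → f ∼ g × IsNecklace 2 3 g × Normal g
normalise {m} f v with proj₂ (IsNecklace.bijective v) zero
... | i , f[i]≡ with adj-min z≤n (subst (λ x → Adj x (toℕ (f (rotate 1 i)))) (cong toℕ (f[i]≡ refl))
                                        (adj (IsNecklace.adjacent v i)))
-- After `opposite`, this rotation takes the first position to `i` and the last one to the successor
-- of `i`, where the 2 is.
... | inj₁ two = _ , (suc (toℕ i) , inj₂ λ _ → refl) , necklace-opposite (necklace-rotate (suc (toℕ i)) v) , record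
  { first = cong toℕ (f[i]≡ back)
  ; last  = trans (cong toℕ (cong (f ∘ rotate (suc (toℕ i))) (opposite-involutive zero)))
      (trans (cong (toℕ ∘ f) (trans (sym (rotate-rotate (toℕ i) 1 zero))
        (trans (rotate-comm (toℕ i) 1 zero) (cong (rotate 1) (rotate-zero i))))) two)
  }
  where
  back : rotate (suc (toℕ i)) (fromℕ m) ≡ i
  back = trans (sym (rotate-rotate (toℕ i) 1 (fromℕ m))) (trans (cong (rotate (toℕ i)) rotate-last) (rotate-zero i))
... | inj₂ three = _ , (toℕ i , inj₁ λ _ → refl) , necklace-rotate (toℕ i) v , record
  { first = cong toℕ (f[i]≡ (rotate-zero i))
  ; last  = before
  }
  where
  p = rotate (toℕ i) (fromℕ m)
  p→i : rotate 1 p ≡ i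
  p→i = trans (rotate-comm 1 (toℕ i) (fromℕ m)) (trans (cong (rotate (toℕ i)) rotate-last) (rotate-zero i))
  -- If the positions before and after `i` coincided, rotation by 2 would fix `i` and hence every
  -- position, which three positions exclude.
  ¬2-cycle : p ≢ rotate 1 i
  ¬2-cycle eq = contradiction
    (trans (sym (rotate-small 2 zero length≥3)) (cong toℕ (rotate-fixed 2 i fixed zero)))
    λ ()
    where
    open IsNecklace v
    fixed : rotate 2 i ≡ i
    fixed = trans (sym (rotate-rotate 1 1 i)) (trans (cong (rotate 1) (sym eq)) p→i)
  before : toℕ (f p) ≡ 2
  before with adj-min z≤n (Adj-sym (subst (λ x → Adj (toℕ (f p)) x)
                (trans (cong (toℕ ∘ f) p→i) (cong toℕ (f[i]≡ refl))) (adj (IsNecklace.adjacent v p))))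
  ... | inj₁ eq = eq
  ... | inj₂ eq = contradiction (proj₁ (IsNecklace.bijective v) (toℕ-injective (trans eq (sym three)))) ¬2-cycle

-- Normal necklaces and cycle codes

-- Two lists without repetition that have the same members are permutations of each other.
entries-↭ : ∀ {a b} {f : Arrangement n} → IsNecklace a b f → entries f ↭ iterate suc 0 n
entries-↭ {n} {f = f} v = ∼bag⇒↭ (unique∧set⇒bag
  (tabulate⁺ (proj₁ bijective ∘ toℕ-injective)) (interval-unique 0 n) (mk⇔ to from))
  where
  open IsNecklace v
  to : ∀ {x} → x ∈ entries f → x ∈ iterate suc 0 n
  to x∈ with i , refl ← ∈-tabulate⁻ {f = toℕ ∘ f} x∈ = ∈-interval⁺ 0 n z≤n (toℕ<n (f i))
  from : ∀ {x} → x ∈ iterate suc 0 n → x ∈ entries f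
  from x∈ with proj₂ bijective (fromℕ< (proj₂ (∈-interval⁻ 0 n x∈)))
  ... | i , eq = subst (_∈ entries f) (trans (cong toℕ (eq refl)) (toℕ-fromℕ< _)) (∈-tabulate⁺ i)

normal-entries : ∀ {f : Arrangement (suc m)} → 3 ≤ suc m → Normal f → ∃ λ s → entries f ≡ 0 ∷ s ∷ʳ 2
normal-entries {suc m} {f} _ nf = tabulate (toℕ ∘ f ∘ suc ∘ inject₁) ,
  trans (cong (_∷ tabulate (toℕ ∘ f ∘ suc)) (first nf))
    (cong (0 ∷_) (trans (tabulate-∷ʳ (toℕ ∘ f ∘ suc)) (cong (tabulate (toℕ ∘ f ∘ suc ∘ inject₁) ∷ʳ_) (last nf))))
normal-entries {zero} (s≤s ())

entries-linked : ∀ {f : Arrangement (suc m)} → IsNecklace 2 3 f → Linked Adj (entries f)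
entries-linked {f = f} v = linked-tabulate⁺ (toℕ ∘ f) λ i →
  adj (subst (Apart 2 3 (toℕ (f (inject₁ i))) ∘ toℕ ∘ f) (rotate-inject₁ i) (adjacent (inject₁ i)))
  where open IsNecklace v

cycle-arrangement : (c : Cycle n) → ∃ λ (f : Arrangement n) → entries f ≡ cyclePath 0 c
cycle-arrangement {n} c = untabulate
  (All.tabulate λ x∈ → proj₂ (∈-interval⁻ 0 n (∈-resp-↭ (cycle-↭ 0 c) x∈)))
  (trans (↭-length (cycle-↭ 0 c)) (length-iterate suc 0 n))

arrange : Cycle n → Arrangement n
arrange c = proj₁ (cycle-arrangement c)

arrange-entries : ∀ (c : Cycle n) → entries (arrange c) ≡ cyclePath 0 c
arrange-entries c = proj₂ (cycle-arrangement c)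

arrange-normal : ∀ (c : Cycle (suc m)) → Normal (arrange c)
arrange-normal c@(close a) = record
  { first = ∷-injectiveˡ (arrange-entries c)
  ; last  = ∷ʳ-injectiveʳ (tabulate (toℕ ∘ arrange c ∘ inject₁)) (0 ∷ 3 ∷ 1 ∷ arcPath 4 a)
      (trans (sym (tabulate-∷ʳ (toℕ ∘ arrange c))) (arrange-entries c))
  }

arrange-necklace : ∀ (c : Cycle n) → IsNecklace 2 3 (arrange c)
arrange-necklace {n} c@(close {m} a) = record
  { length≥3  = s≤s (s≤s (s≤s z≤n))
  ; bijective = (unique-tabulate⁻ (Permuted.unique f↭) ∘ cong toℕ) , surjective
  ; adjacent  = λ i → Adj.difference (adjacent i)
  }
  where
  f = arrange c
  f↭ : entries f ↭ iterate suc 0 n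
  f↭ = subst (_↭ iterate suc 0 n) (sym (arrange-entries c)) (cycle-↭ 0 c)
  surjective : ∀ y → ∃ λ x → ∀ {z} → z ≡ x → f z ≡ y
  surjective y with ∈-tabulate⁻ {f = toℕ ∘ f} (∈-resp-↭ (↭-sym f↭) (∈-interval⁺ 0 n z≤n (toℕ<n y)))
  ... | i , eq = i , λ { refl → sym (toℕ-injective eq) }
  adjacent : ∀ i → Adj (toℕ (f i)) (toℕ (f (rotate 1 i)))
  adjacent i with view i
  -- The pair across the cut: the last entry 2, followed by 0.
  ... | ‵fromℕ     rewrite rotate-last {3 + m} | first (arrange-normal c) | last (arrange-normal c) = Adj-sym (adj₂ 0)
  ... | ‵inject₁ j rewrite rotate-inject₁ j =
    linked-tabulate⁻ (toℕ ∘ f) (subst (Linked Adj) (sym (arrange-entries c)) (cycle-linked 0 c)) j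

arrange-injective : ∀ (c d : Cycle n) → arrange c ∼ arrange d → c ≡ d
arrange-injective c@(close _) d c∼d = cyclePath-injective 0 c d
  (trans (sym (arrange-entries c)) (trans (tabulate-cong (cong toℕ ∘ c≗d)) (arrange-entries d)))
  where c≗d = normal-∼⇒≗ (arrange-necklace c) (arrange-normal c) (arrange-normal d) c∼d

arrange-surjective : ∀ (f : Arrangement n) → IsNecklace 2 3 f → ∃ λ (c : Cycle n) → arrange c ∼ f
arrange-surjective {zero} f v with () ← IsNecklace.length≥3 v
arrange-surjective {suc m} f v with normalise f v
... | g , f∼g , w , norm with normal-entries (IsNecklace.length≥3 w) norm
... | s , eq with cyclePath-surjective (suc m) s (subst (_↭ iterate suc 0 (suc m)) eq (entries-↭ w))
                                                 (subst (Linked Adj) eq (entries-linked w))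
... | c , eq′ = c , ∼-sym {f = f} (∼-trans {f = f} {g} f∼g (0 , inj₁ c≗g))
  where
  c≗g : ∀ i → arrange c i ≡ g (rotate 0 i)
  c≗g i = trans
    (toℕ-injective (tabulate-injective (toℕ ∘ arrange c) (toℕ ∘ g)
      (trans (arrange-entries c) (trans eq′ (sym eq))) i))
    (cong g (sym (rotate-n* 0 i)))

-- Counting

Cycle⤖Necklace : ∀ n → Bijection (setoid (Cycle n)) (necklaceSetoid 2 3 n)
Cycle⤖Necklace n = record
  { to        = λ c → arrange c , arrange-necklace c
  ; cong      = λ { {c} refl → ∼-refl {f = arrange c} }
  ; bijective = arrange-injective _ _
              , λ (f , v) → proj₁ (arrange-surjective f v) , λ { refl → proj₂ (arrange-surjective f v) }
  }

N↔Cycle : ∀ n → Fin (N 2 3 n) ↔ Cycle n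
N↔Cycle n = Compose.inverse (Bijection⇒Inverse (N-counts 2 3 n))
                            (Symmetry.inverse (Bijection⇒Inverse (Cycle⤖Necklace n)))

-- A cycle is a closed arc on four vertices fewer. An arc on `3 + n` vertices is a hop over an arc
-- on `2 + n`, which closes to a cycle on `6 + n`, or a loop over a cycle on `2 + n`.
Cycle-recurrence : ∀ n → Cycle (7 + n) ↔ (Cycle (6 + n) ⊎ Cycle (2 + n))
Cycle-recurrence n = mk↔ₛ′ split join split-join join-split
  where
  split : Cycle (7 + n) → Cycle (6 + n) ⊎ Cycle (2 + n)
  split (close (hop a))  = inj₁ (close a)
  split (close (loop c)) = inj₂ c
  join : Cycle (6 + n) ⊎ Cycle (2 + n) → Cycle (7 + n)
  join (inj₁ (close a)) = close (hop a)
  join (inj₂ c)         = close (loop c)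
  split-join : ∀ x → split (join x) ≡ x
  split-join (inj₁ (close a)) = refl
  split-join (inj₂ c)         = refl
  join-split : ∀ c → join (split c) ≡ c
  join-split (close (hop a))  = refl
  join-split (close (loop c)) = refl

N-recurrence : ∀ n → N 2 3 (7 + n) ≡ N 2 3 (6 + n) + N 2 3 (2 + n)
N-recurrence n = ↔⇒≡ (↔-trans (N↔Cycle (7 + n)) (↔-trans (Cycle-recurrence n)
  (↔-sym (↔-trans +↔⊎ (N↔Cycle (6 + n) ⊎-↔ N↔Cycle (2 + n))))))

N-zero : ∀ n → ¬ Cycle n → N 2 3 n ≡ 0
N-zero n empty = ↔⇒≡ (↔-trans (N↔Cycle n)
  (mk↔ₛ′ (λ c → contradiction c empty) (λ ()) (λ ()) (λ c → contradiction c empty)))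

N-five : N 2 3 5 ≡ 1
N-five = ↔⇒≡ (↔-trans (N↔Cycle 5)
  (mk↔ₛ′ (λ _ → zero) (λ _ → close point) (λ { zero → refl }) λ { (close point) → refl ; (close (loop ())) }))

-- A cycle has four vertices more than its arc, and no arc has zero vertices.
¬cycle<5 : n < 5 → ¬ Cycle n
¬cycle<5 (s≤s (s≤s (s≤s (s≤s (s≤s z≤n))))) (close ())

mainTheorem5 : (∀ (n : ℕ) → 8 ≤ n → N 2 3 n ≡ N 2 3 (n ∸ 1) + N 2 3 (n ∸ 5))
    × N 2 3 5 ≡ 1
    × N 2 3 6 ≡ 0
    × N 2 3 7 ≡ 0
    × (∀ (n : ℕ) → n < 5 → N 2 3 n ≡ 0)
mainTheorem5 = recurrence , N-five
  -- Arcs on two or three vertices would come down to a cycle on one or two vertices.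
  , N-zero 6 (λ { (close (loop ())) })
  , N-zero 7 (λ { (close (hop (loop ()))) ; (close (loop ())) })
  , λ n n<5 → N-zero n (¬cycle<5 n<5)
  where
  recurrence : ∀ n → 8 ≤ n → N 2 3 n ≡ N 2 3 (n ∸ 1) + N 2 3 (n ∸ 5)
  recurrence _ (s≤s (s≤s (s≤s (s≤s (s≤s (s≤s (s≤s (s≤s {n = n} z≤n)))))))) = N-recurrence (suc n)
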